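{- For any convex polytope $P$, $$s(P)=s(G_P)=s(K_P)=s(U_P).$$
   Context: Let $P=\{x\in\mathbb{R}^n\mid \langle a_i,x\rangle+b_i\geqslant 0,\ i=1,\dots,m\}$ be a (bounded) $n$-dimensional convex polytope, not necessarily simple, whose facets are exactly the $m$ distinct sets $\mathcal{F}_i=\{x\in P\mid\langle a_i,x\rangle+b_i=0\}$. Write $[m]=\{1,\dots,m\}$. The torus $T^m=(S^1)^m$ acts on $\mathbb{C}^m$ coordinatewise; a toric subgroup of rank $k$ is a subgroup of $T^m$ that is a $k$-dimensional subtorus. Hypergraphs: a hypergraph is a subset $G\subseteq 2^{[m]}$. $G_P=\{\{i\mid x\in\mathcal{F}_i\}: x\in P\}$, and $K_P$ is its simplicial closure (smallest simplicial complex containing $G_P$), i.e. $\{i_1,\dots,i_k\}\in K_P$ iff $\mathcal{F}_{i_1}\cap\dots\cap\mathcal{F}_{i_k}\neq\varnothing$. Spaces with $T^m$-action: (a) $\mathcal{Z}_P=p^{ -1}(j_P(P))\subset\mathbb{C}^m$, where $j_P(x)=(\langle a_1,x\rangle+b_1,\dots,\langle a_m,x\rangle+b_m)$ and $p(z_1,\dots,z_m)=(|z_1|^2,\dots,|z_m|^2)$. (b) For a pair $(X,A)$ and a hypergraph $G$, $(X,A)^G=\bigcup_{\alpha\in G}X^\alpha\times A^{[m]\setminus\alpha}\subseteq X^m$. For a hypergraph $G$ (in particular for a simplicial complex), $\mathcal{Z}_G=(D^2,S^1)^G$, with $D^2\subset\mathbb{C}$ the closed unit disk. (c) $U_P=(\mathbb{C},\mathbb{C}\setminus\{0\})^{G_P}=(\mathbb{C},\mathbb{C}\setminus\{0\})^{K_P}\subseteq\mathbb{C}^m$,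 the complement of the corresponding coordinate subspace arrangement. Buchstaber numbers: $s(P)$, $s(G)$ (for $G$ a hypergraph, in particular $G=G_P$ or $G=K_P$), and $s(U_P)$ are the maximal ranks of toric subgroups of $T^m$ acting freely on $\mathcal{Z}_P$, on $\mathcal{Z}_G$, and on $U_P$ respectively. -}

module Defs where

open import Algebra.Bundles using (CommutativeRing; AbelianGroup)
open import Algebra.Morphism.Structures using (module GroupMorphisms)
import Algebra.Construct.Pointwise as Pointwise
import Algebra.Properties.Ring as RingProperties
import Algebra.Properties.Semiring.Sum as SemiringSum
import Algebra.Solver.Ring.NaturalCoefficients.Default as SemiringSolver
open import Data.Fin.Base using (Fin)
open import Data.Fin.Subset using (Subset) renaming (_∈_ to _∈ₛ_; _∉_ to _∉ₛ_; _⊆_ to _⊆ₛ_)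
open import Data.Nat.Base as ℕ using (ℕ)
open import Data.Product.Base using (Σ; ∃; ∃₂; _×_; _,_; proj₁; proj₂)
open import Data.Vec.Functional using (Vector)
open import Function.Bundles using (_⇔_)
open import Level using (0ℓ)
open import Relation.Binary.Core using (Rel)
open import Relation.Binary.Structures using (IsTotalOrder)
open import Relation.Binary.PropositionalEquality.Core using (_≡_)
import Relation.Binary.Construct.NonStrictToStrict as NonStrictToStrict
import Relation.Binary.Reasoning.Setoid as ≈-Reasoning
open import Relation.Nullary.Negation.Core using (¬_)
open import Relation.Unary using (Pred; _∈_; _≐_; U; Satisfiable)

-- The real numbers, given axiomatically: classically these axioms
-- determine ℝ up to unique isomorphism.

record CompleteOrderedField : Set₁ where
  field
    commutativeRing : CommutativeRing 0ℓ 0ℓ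

  open CommutativeRing commutativeRing public

  infix 4 _≤_
  field
    1≉0          : ¬ (1# ≈ 0#)
    inverse      : ∀ x → ¬ (x ≈ 0#) → ∃ λ y → x * y ≈ 1#
    _≤_          : Rel Carrier 0ℓ
    isTotalOrder : IsTotalOrder _≈_ _≤_
    +-monoʳ-≤    : ∀ x {y z} → y ≤ z → x + y ≤ x + z
    *-nonNeg     : ∀ {x y} → 0# ≤ x → 0# ≤ y → 0# ≤ x * y

  open NonStrictToStrict _≈_ _≤_ public using (_<_)

  UpperBound : Pred Carrier 0ℓ → Pred Carrier 0ℓ
  UpperBound S b = ∀ x → x ∈ S → x ≤ b

  field
    complete : ∀ (S : Pred Carrier 0ℓ) → Satisfiable S → Satisfiable (UpperBound S) →
               ∃ λ s → s ∈ UpperBound S × (∀ b → b ∈ UpperBound S → s ≤ b)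

Hypergraph : ℕ → Set₁
Hypergraph m = Pred (Subset m) 0ℓ

data SimplicialClosure {m : ℕ} (G : Hypergraph m) : Hypergraph m where
  generator : ∀ {α} → α ∈ G → α ∈ SimplicialClosure G
  face      : ∀ {α β} → β ⊆ₛ α → α ∈ SimplicialClosure G → β ∈ SimplicialClosure G

module ToricTopology (R : CompleteOrderedField) where

  open CompleteOrderedField R
  open SemiringSum semiring using (sum)

  ℝ : Set
  ℝ = Carrier

  ⟨_,_⟩ : ∀ {n} → Vector ℝ n → Vector ℝ n → ℝ
  ⟨ c , x ⟩ = sum (λ i → c i * x i)

  AffinelyIndependent : ∀ {n k} → (Fin k → Vector ℝ n) → Set
  AffinelyIndependent {n} {k} v =
    ∀ (c : Vector ℝ k) → sum c ≈ 0# → (∀ j → sum (λ i → c i * v i j) ≈ 0#) →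
    ∀ i → c i ≈ 0#

  AffineHull : ∀ {n k} → (Fin k → Vector ℝ n) → Pred (Vector ℝ n) 0ℓ
  AffineHull {n} {k} v x =
    ∃ λ (c : Vector ℝ k) → sum c ≈ 1# × (∀ j → x j ≈ sum (λ i → c i * v i j))

  -- The affine hull of S has dimension d (in particular, S is nonempty).
  HasDimension : ∀ {n} → Pred (Vector ℝ n) 0ℓ → ℕ → Set
  HasDimension {n} S d =
    ∃ λ (v : Fin (ℕ.suc d) → Vector ℝ n) →
      (∀ i → v i ∈ S) × AffinelyIndependent v × (∀ x → x ∈ S → x ∈ AffineHull v)

  Bounded : ∀ {n} → Pred (Vector ℝ n) 0ℓ → Set
  Bounded S = ∃ λ M → ∀ x → x ∈ S → ∀ j → - M ≤ x j × x j ≤ M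

  IsFace : ∀ {n} → Pred (Vector ℝ n) 0ℓ → Pred (Vector ℝ n) 0ℓ → Set
  IsFace S F = ∃₂ λ c d →
    (∀ x → x ∈ S → 0# ≤ ⟨ c , x ⟩ + d) ×
    (F ≐ λ x → x ∈ S × ⟨ c , x ⟩ + d ≈ 0#)

  IsFacet : ∀ {n} → Pred (Vector ℝ n) 0ℓ → Pred (Vector ℝ n) 0ℓ → Set
  IsFacet {n} S F = IsFace S F × ∃ λ d → ℕ.suc d ≡ n × HasDimension F d

  record Polytope (n m : ℕ) : Set₁ where
    field
      a : Fin m → Vector ℝ n
      b : Vector ℝ m

    j : Vector ℝ n → Vector ℝ m
    j x i = ⟨ a i , x ⟩ + b i

    points : Pred (Vector ℝ n) 0ℓ
    points x = ∀ i → 0# ≤ j x i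

    ℱ : Fin m → Pred (Vector ℝ n) 0ℓ
    ℱ i x = x ∈ points × j x i ≈ 0#

    field
      bounded         : Bounded points
      fullDimensional : HasDimension points n
      ℱ-isFacet       : ∀ i → IsFacet points (ℱ i)
      ℱ-exhaustive    : ∀ F → IsFacet points F → ∃ λ i → F ≐ ℱ i
      ℱ-distinct      : ∀ i k → ℱ i ≐ ℱ k → i ≡ k

  -- Complex numbers as pairs (real part , imaginary part)

  ℂ : Set
  ℂ = ℝ × ℝ

  infix 4 _≈ᶜ_
  _≈ᶜ_ : Rel ℂ 0ℓ
  (a , b) ≈ᶜ (c , d) = a ≈ c × b ≈ d

  0ᶜ 1ᶜ : ℂ
  0ᶜ = 0# , 0#
  1ᶜ = 1# , 0#

  infixl 7 _*ᶜ_
  infixl 6 _-ᶜ_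
  _*ᶜ_ _-ᶜ_ : ℂ → ℂ → ℂ
  (a , b) *ᶜ (c , d) = a * c - b * d , a * d + b * c
  (a , b) -ᶜ (c , d) = a - c , b - d

  conj : ℂ → ℂ
  conj (a , b) = a , - b

  ∣_∣² : ℂ → ℝ
  ∣ a , b ∣² = a * a + b * b

  D² S¹ ℂ* : Pred ℂ 0ℓ
  D² z = ∣ z ∣² ≤ 1#
  S¹ z = ∣ z ∣² ≈ 1#
  ℂ* z = ¬ (z ≈ᶜ 0ᶜ)

  private
    module RP = RingProperties ring
    module Solver = SemiringSolver commutativeSemiring
    open Solver using (solve; _:=_; _:+_; _:*_)
    open ≈-Reasoning setoid

    n : ℝ
    n = - 1#

    nn≈1 : n * n ≈ 1#
    nn≈1 = trans (RP.-1*x≈-x n) (RP.-‿involutive 1#)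

    -- The semiring solver treats n as an atom standing for the sign.
    sub : ∀ x y → x - y ≈ x + n * y
    sub x y = +-congˡ (sym (RP.-1*x≈-x y))

  *ᶜ-cong : ∀ {z z′ w w′} → z ≈ᶜ z′ → w ≈ᶜ w′ → z *ᶜ w ≈ᶜ z′ *ᶜ w′
  *ᶜ-cong (p , q) (r , s) =
    +-cong (*-cong p r) (-‿cong (*-cong q s)) ,
    +-cong (*-cong p s) (*-cong q r)

  *ᶜ-assoc : ∀ z w v → (z *ᶜ w) *ᶜ v ≈ᶜ z *ᶜ (w *ᶜ v)
  *ᶜ-assoc (a , b) (c , d) (e , f) = re , im
    where
    re = begin
      (a * c - b * d) * e - (a * d + b * c) * f
        ≈⟨ trans (sub _ _) (+-congʳ (*-congʳ (sub _ _))) ⟩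
      (a * c + n * (b * d)) * e + n * ((a * d + b * c) * f)
        ≈⟨ solve 7 (λ a b c d e f n →
             (a :* c :+ n :* (b :* d)) :* e :+ n :* ((a :* d :+ b :* c) :* f) :=
             a :* (c :* e :+ n :* (d :* f)) :+ n :* (b :* (c :* f :+ d :* e)))
             refl a b c d e f n ⟩
      a * (c * e + n * (d * f)) + n * (b * (c * f + d * e))
        ≈⟨ trans (sub _ _) (+-congʳ (*-congˡ (sub _ _))) ⟨
      a * (c * e - d * f) - b * (c * f + d * e) ∎
    im = begin
      (a * c - b * d) * f + (a * d + b * c) * e
        ≈⟨ +-congʳ (*-congʳ (sub _ _)) ⟩
      (a * c + n * (b * d)) * f + (a * d + b * c) * e
        ≈⟨ solve 7 (λ a b c d e f n →
             (a :* c :+ n :* (b :* d)) :* f :+ (a :* d :+ b :* c) :* e :=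
             a :* (c :* f :+ d :* e) :+ b :* (c :* e :+ n :* (d :* f)))
             refl a b c d e f n ⟩
      a * (c * f + d * e) + b * (c * e + n * (d * f))
        ≈⟨ +-congˡ (*-congˡ (sub _ _)) ⟨
      a * (c * f + d * e) + b * (c * e - d * f) ∎

  *ᶜ-comm : ∀ z w → z *ᶜ w ≈ᶜ w *ᶜ z
  *ᶜ-comm (a , b) (c , d) =
    +-cong (*-comm a c) (-‿cong (*-comm b d)) ,
    trans (+-comm (a * d) (b * c)) (+-cong (*-comm b c) (*-comm a d))

  *ᶜ-identityˡ : ∀ z → 1ᶜ *ᶜ z ≈ᶜ z
  *ᶜ-identityˡ (a , b) =
    trans (+-cong (*-identityˡ a) (trans (-‿cong (zeroˡ b)) RP.-0#≈0#)) (+-identityʳ a) ,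
    trans (+-cong (*-identityˡ b) (zeroˡ a)) (+-identityʳ b)

  *ᶜ-conj : ∀ z → z *ᶜ conj z ≈ᶜ (∣ z ∣² , 0#)
  *ᶜ-conj (a , b) =
    +-congˡ (trans (-‿cong (sym (RP.-‿distribʳ-* b b))) (RP.-‿involutive _)) ,
    trans (+-cong (sym (RP.-‿distribʳ-* a b)) (*-comm b a)) (-‿inverseˡ (a * b))

  ∣∣²-* : ∀ z w → ∣ z *ᶜ w ∣² ≈ ∣ z ∣² * ∣ w ∣²
  ∣∣²-* (a , b) (c , d) = begin
    (a * c - b * d) * (a * c - b * d) + (a * d + b * c) * (a * d + b * c)
      ≈⟨ +-congʳ (*-cong (sub _ _) (sub _ _)) ⟩
    (a * c + n * (b * d)) * (a * c + n * (b * d)) + (a * d + b * c) * (a * d + b * c)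
      ≈⟨ solve 5 (λ a b c d n →
           (a :* c :+ n :* (b :* d)) :* (a :* c :+ n :* (b :* d))
             :+ (a :* d :+ b :* c) :* (a :* d :+ b :* c) :=
           ((a :* c) :* (a :* c) :+ (n :* n) :* ((b :* d) :* (b :* d)))
             :+ ((a :* d) :* (a :* d) :+ (b :* c) :* (b :* c))
             :+ (n :* ((a :* c) :* (b :* d)) :+ (a :* c) :* (b :* d))
             :+ (n :* ((a :* c) :* (b :* d)) :+ (a :* c) :* (b :* d)))
           refl a b c d n ⟩
    ((a * c) * (a * c) + (n * n) * ((b * d) * (b * d)))
      + ((a * d) * (a * d) + (b * c) * (b * c))
      + (n * ((a * c) * (b * d)) + (a * c) * (b * d))
      + (n * ((a * c) * (b * d)) + (a * c) * (b * d))
      ≈⟨ +-cong (+-cong (+-congʳ (+-congˡ (trans (*-congʳ nn≈1) (*-identityˡ _)))) cancel) cancel ⟩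
    ((a * c) * (a * c) + (b * d) * (b * d))
      + ((a * d) * (a * d) + (b * c) * (b * c)) + 0# + 0#
      ≈⟨ trans (+-identityʳ _) (+-identityʳ _) ⟩
    ((a * c) * (a * c) + (b * d) * (b * d)) + ((a * d) * (a * d) + (b * c) * (b * c))
      ≈⟨ solve 4 (λ a b c d →
           ((a :* c) :* (a :* c) :+ (b :* d) :* (b :* d))
             :+ ((a :* d) :* (a :* d) :+ (b :* c) :* (b :* c)) :=
           (a :* a :+ b :* b) :* (c :* c :+ d :* d)) refl a b c d ⟩
    (a * a + b * b) * (c * c + d * d) ∎
    where
    cancel : ∀ {x} → n * x + x ≈ 0#
    cancel {x} = trans (+-congʳ (RP.-1*x≈-x x)) (-‿inverseˡ x)

  ∣1∣² : ∣ 1ᶜ ∣² ≈ 1#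
  ∣1∣² = trans (+-cong (*-identityˡ 1#) (zeroˡ 0#)) (+-identityʳ 1#)

  ∣conj∣² : ∀ z → ∣ conj z ∣² ≈ ∣ z ∣²
  ∣conj∣² (a , b) = +-congˡ (trans (sym (RP.-‿distribˡ-* b (- b)))
    (trans (-‿cong (sym (RP.-‿distribʳ-* b b))) (RP.-‿involutive _)))

  circle : AbelianGroup 0ℓ 0ℓ
  circle = record
    { Carrier = Σ ℂ S¹
    ; _≈_     = λ s t → proj₁ s ≈ᶜ proj₁ t
    ; _∙_     = λ { (z , p) (w , q) →
                    z *ᶜ w , trans (∣∣²-* z w) (trans (*-cong p q) (*-identityˡ 1#)) }
    ; ε       = 1ᶜ , ∣1∣²
    ; _⁻¹     = λ { (z , p) → conj z , trans (∣conj∣² z) p }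
    ; isAbelianGroup = record
      { isGroup = record
        { isMonoid = record
          { isSemigroup = record
            { isMagma = record
              { isEquivalence = record
                { refl  = refl , refl
                ; sym   = λ (p , q) → sym p , sym q
                ; trans = λ (p , q) (r , s) → trans p r , trans q s
                }
              ; ∙-cong = *ᶜ-cong
              }
            ; assoc = λ s t u → *ᶜ-assoc (proj₁ s) (proj₁ t) (proj₁ u)
            }
          ; identity = (λ t → *ᶜ-identityˡ (proj₁ t)) ,
                       (λ t → comm-trans (proj₁ t) 1ᶜ (*ᶜ-identityˡ (proj₁ t)))
          }
        ; inverse = (λ t → comm-trans (conj (proj₁ t)) (proj₁ t) (inverseʳ t)) , inverseʳ
        ; ⁻¹-cong = λ (p , q) → p , -‿cong q
        }
      ; comm = λ s t → *ᶜ-comm (proj₁ s) (proj₁ t)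
      }
    }
    where
    comm-trans : ∀ z w {v} → w *ᶜ z ≈ᶜ v → z *ᶜ w ≈ᶜ v
    comm-trans z w (p , q) =
      trans (proj₁ (*ᶜ-comm z w)) p , trans (proj₂ (*ᶜ-comm z w)) q

    inverseʳ : ∀ (t : Σ ℂ S¹) → proj₁ t *ᶜ conj (proj₁ t) ≈ᶜ 1ᶜ
    inverseʳ (z , p) = trans (proj₁ (*ᶜ-conj z)) p , proj₂ (*ᶜ-conj z)

  torus : ℕ → AbelianGroup 0ℓ 0ℓ
  torus m = Pointwise.abelianGroup (Fin m) circle

  T : ℕ → Set
  T m = AbelianGroup.Carrier (torus m)

  infix 4 _≈ᵀ_
  _≈ᵀ_ : ∀ {m} → Rel (T m) 0ℓ
  _≈ᵀ_ {m} = AbelianGroup._≈_ (torus m)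

  1ᵀ : ∀ {m} → T m
  1ᵀ {m} = AbelianGroup.ε (torus m)

  -- s and t are within distance ε in the maximum metric on T m ⊂ ℂᵐ
  -- (for ε > 0); this metric induces the product topology.
  Close : ∀ {m} → ℝ → Rel (T m) 0ℓ
  Close ε s t = ∀ i → ∣ proj₁ (s i) -ᶜ proj₁ (t i) ∣² < ε * ε

  -- A subgroup of T m together with an isomorphism of topological groups
  -- from T k onto it, packaged as a topological embedding φ.
  record ToricSubgroup (k m : ℕ) : Set where
    open GroupMorphisms (AbelianGroup.rawGroup (torus k)) (AbelianGroup.rawGroup (torus m))
    field
      φ                   : T k → T m
      isGroupMonomorphism : IsGroupMonomorphism φ
      φ-continuous        : ∀ s ε → 0# < ε → ∃ λ δ → 0# < δ ×
                           (∀ t → Close δ s t → Close ε (φ s) (φ t))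
      φ⁻¹-continuous      : ∀ s ε → 0# < ε → ∃ λ δ → 0# < δ ×
                           (∀ t → Close δ (φ s) (φ t) → Close ε s t)

    subgroup : Pred (T m) 0ℓ
    subgroup t = ∃ λ s → φ s ≈ᵀ t

  infix 4 _≈ᵛ_
  _≈ᵛ_ : ∀ {m} → Rel (Vector ℂ m) 0ℓ
  z ≈ᵛ w = ∀ i → z i ≈ᶜ w i

  infixr 7 _·_
  _·_ : ∀ {m} → T m → Vector ℂ m → Vector ℂ m
  (t · z) i = proj₁ (t i) *ᶜ z i

  ActsFreely : ∀ {m} → Pred (T m) 0ℓ → Pred (Vector ℂ m) 0ℓ → Set
  ActsFreely H X = ∀ t → t ∈ H → ∀ z → z ∈ X → t · z ≈ᵛ z → t ≈ᵀ 1ᵀ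

  FreeRank : ∀ {m} → Pred (Vector ℂ m) 0ℓ → ℕ → Set
  FreeRank {m} X k = ∃ λ (H : ToricSubgroup k m) → ActsFreely (ToricSubgroup.subgroup H) X

  IsBuchstaberNumber : ∀ {m} → Pred (Vector ℂ m) 0ℓ → ℕ → Set
  IsBuchstaberNumber X s = FreeRank X s × (∀ k → FreeRank X k → k ℕ.≤ s)

  PolyhedralProduct : ∀ {m} → Pred ℂ 0ℓ → Pred ℂ 0ℓ → Hypergraph m → Pred (Vector ℂ m) 0ℓ
  PolyhedralProduct X A G z =
    ∃ λ α → α ∈ G × (∀ i → i ∈ₛ α → z i ∈ X) × (∀ i → i ∉ₛ α → z i ∈ A)

  𝒵 : ∀ {m} → Hypergraph m → Pred (Vector ℂ m) 0ℓ
  𝒵 = PolyhedralProduct D² S¹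

  module _ {n m : ℕ} (P : Polytope n m) where
    open Polytope P

    G[_] : Hypergraph m
    G[_] α = ∃ λ x → x ∈ points × (∀ i → i ∈ₛ α ⇔ x ∈ ℱ i)

    K[_] : Hypergraph m
    K[_] = SimplicialClosure G[_]

    𝒵[_] : Pred (Vector ℂ m) 0ℓ
    𝒵[_] z = ∃ λ x → x ∈ points × (∀ i → ∣ z i ∣² ≈ j x i)

    U[_] : Pred (Vector ℂ m) 0ℓ
    U[_] = PolyhedralProduct U ℂ* G[_]

{-# OPTIONS --safe #-}

-- A torus element t fixes z exactly when tᵢ = 1 wherever zᵢ ≠ 0, so whether a
-- subgroup acts freely on X depends only on the zero sets of the points of X,
-- and among these only on a family containing a superset of each. For all four
-- spaces G_P is such a family (for 𝒵_P this uses square roots), hence the same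
-- subgroups act freely on each of them. The maximum exists since the rank of a
-- toric subgroup of T^m is at most m: a monomorphism T^k → T^m embeds the 2^k
-- elements of order dividing two of T^k into the 2^m ones of T^m.

module Submission where

open import Algebra.Bundles using (AbelianGroup)
import Algebra.Properties.Group as GroupProperties
import Algebra.Properties.Ring as RingProperties
import Algebra.Solver.Ring.NaturalCoefficients.Default as SemiringSolver
open import Algebra.Morphism.Structures using (module GroupMorphisms)
open import Axiom.ExcludedMiddle using (ExcludedMiddle)
open import Data.Bool.Base using (Bool; true; if_then_else_)
open import Data.Fin.Base using (Fin; zero; suc; combine; finToFun; funToFin)
import Data.Fin.Properties as Fin
open import Data.Fin.Subset using (Subset) renaming (_∈_ to _∈ₛ_; _∉_ to _∉ₛ_; _⊆_ to _⊆ₛ_)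
open import Data.Fin.Subset.Properties using (_∈?_)
open import Data.Nat.Base using (ℕ)
import Data.Nat.Base as ℕ
import Data.Nat.Properties as ℕ
open import Data.Product.Base using (_×_; ∃; ∃-syntax; _,_; proj₁; proj₂)
open import Data.Sum.Base using (inj₁; inj₂)
open import Data.Unit.Base using (tt)
open import Data.Vec.Base using (tabulate)
open import Data.Vec.Functional using (Vector)
open import Data.Vec.Properties using (lookup∘tabulate; lookup⇒[]=; []=⇒lookup)
open import Function.Base using (_∘_; _$_)
open import Function.Bundles using (_⇔_; mk⇔; module Equivalence)
open import Level using (0ℓ)
open import Relation.Binary.Bundles using (TotalOrder)
open import Relation.Binary.PropositionalEquality.Core as ≡ using (_≡_; _≗_)
import Relation.Binary.Reasoning.Setoid as ≈-Reasoning
import Relation.Binary.Reasoning.PartialOrder as PartialOrderReasoning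
open import Relation.Nullary.Decidable.Core using (Dec; yes; no; does)
open import Relation.Nullary.Decidable using (dec-true)
open import Relation.Nullary.Negation.Core using (¬_; contradiction)
open import Relation.Unary using (Pred; U; _∈_)
open import Defs

-- Subsets, maxima and counting under excluded middle.

does⇒holds : ∀ {A : Set} (a? : Dec A) → does a? ≡ true → A
does⇒holds (yes a) _ = a

comprehension : ExcludedMiddle 0ℓ → ∀ {m} (Q : Pred (Fin m) 0ℓ) →
                ∃ λ (α : Subset m) → ∀ i → i ∈ₛ α ⇔ Q i
comprehension em Q = tabulate f , λ i → mk⇔
  (λ i∈α → does⇒holds em (≡.trans (≡.sym (lookup∘tabulate f i)) ([]=⇒lookup i∈α)))
  (λ q → lookup⇒[]= i _ (≡.trans (lookup∘tabulate f i) (dec-true em q)))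
  where
  f : Fin _ → Bool
  f i = does (em {Q i})

-- Searches downwards from `b`; `Q 0` provides the answer when the bound reaches zero.
greatest : ExcludedMiddle 0ℓ → ∀ (Q : Pred ℕ 0ℓ) → Q 0 → ∀ b → (∀ k → Q k → k ℕ.≤ b) →
           ∃ λ s → Q s × (∀ k → Q k → k ℕ.≤ s)
greatest em Q q₀ ℕ.zero    bound = 0 , q₀ , bound
greatest em Q q₀ (ℕ.suc b) bound with em {Q (ℕ.suc b)}
... | yes q = ℕ.suc b , q , bound
... | no ¬q = greatest em Q q₀ b λ k q →
  ℕ.s≤s⁻¹ (ℕ.≤∧≢⇒< (bound k q) λ { ≡.refl → ¬q q })

-- Maps into a two-element set are coded as numbers below `2 ^ k` and `2 ^ m`, so the pigeonhole
-- principle excludes `m < k`. Injectivity is taken up to pointwise equality.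
injective⇒exponent≤ : ∀ {k m} (f : (Fin k → Fin 2) → (Fin m → Fin 2)) →
                      (∀ e e′ → f e ≗ f e′ → e ≗ e′) → k ℕ.≤ m
injective⇒exponent≤ {k} {m} f inj =
  ℕ.≮⇒≥ λ m<k → ℕ.≤⇒≯ (Fin.injective⇒≤ code-injective) (ℕ.^-monoʳ-< 2 (ℕ.n<1+n 1) m<k)
  where
  code : Fin (2 ℕ.^ k) → Fin (2 ℕ.^ m)
  code c = funToFin (f (finToFun c))

  code-injective : ∀ {c c′} → code c ≡ code c′ → c ≡ c′
  code-injective {c} {c′} eq =
    ≡.trans (≡.sym (Fin.funToFin-finToFin {k} {2} c))
      (≡.trans (funToFin-cong (inj (finToFun c) (finToFun c′) λ i →
        ≡.trans (≡.sym (Fin.finToFun-funToFin (f (finToFun c)) i))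
          (≡.trans (≡.cong (λ d → finToFun d i) eq)
            (Fin.finToFun-funToFin (f (finToFun c′)) i))))
        (Fin.funToFin-finToFin {k} {2} c′))
    where
    funToFin-cong : ∀ {k n} {g h : Fin k → Fin n} → g ≗ h → funToFin g ≡ funToFin h
    funToFin-cong {ℕ.zero}  g≗h = ≡.refl
    funToFin-cong {ℕ.suc k} g≗h =
      ≡.cong₂ combine (g≗h zero) (funToFin-cong (g≗h ∘ suc))

-- Arithmetic in an ordered field.

module OrderedFieldProperties (R : CompleteOrderedField) where

  open CompleteOrderedField R
  private
    module G = GroupProperties +-group

  totalOrder : TotalOrder 0ℓ 0ℓ 0ℓ
  totalOrder = record { isTotalOrder = isTotalOrder }

  open TotalOrder totalOrder using (poset; total; antisym)
    renaming (trans to ≤-trans; reflexive to ≤-reflexive; ≤-respʳ-≈ to ≤-respʳ; ≤-respˡ-≈ to ≤-respˡ)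
  open PartialOrderReasoning poset
  open SemiringSolver commutativeSemiring using (solve; _:=_; _:+_; _:*_; con)

  x≤x+y : ∀ {x y} → 0# ≤ y → x ≤ x + y
  x≤x+y {x} 0≤y = ≤-respˡ (+-identityʳ x) (+-monoʳ-≤ x 0≤y)

  +-nonNeg : ∀ {x y} → 0# ≤ x → 0# ≤ y → 0# ≤ x + y
  +-nonNeg 0≤x 0≤y = ≤-trans 0≤x (x≤x+y 0≤y)

  -- Turns an inequality into an equation with a nonnegative difference `d`, which the semiring
  -- solver can handle without subtraction.
  ≤⇒∃+ : ∀ {x y} → x ≤ y → ∃ λ d → 0# ≤ d × y ≈ x + d
  ≤⇒∃+ {x} {y} x≤y =
    - x + y , ≤-respˡ (-‿inverseˡ x) (+-monoʳ-≤ (- x) x≤y) , sym (G.\\-leftDividesˡ x y)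

  +-cancelˡ-≤ : ∀ z {x y} → z + x ≤ z + y → x ≤ y
  +-cancelˡ-≤ z {x} {y} p =
    ≤-respˡ (G.\\-leftDividesʳ z x) (≤-respʳ (G.\\-leftDividesʳ z y) (+-monoʳ-≤ (- z) p))

  *-monoˡ-≤ : ∀ {z x y} → 0# ≤ z → x ≤ y → z * x ≤ z * y
  *-monoˡ-≤ {z} {x} {y} 0≤z x≤y with d , 0≤d , y≈x+d ← ≤⇒∃+ x≤y = begin
    z * x          ≤⟨ x≤x+y (*-nonNeg 0≤z 0≤d) ⟩
    z * x + z * d  ≈⟨ distribˡ z x d ⟨
    z * (x + d)    ≈⟨ *-congˡ y≈x+d ⟨
    z * y          ∎

  square-nonNeg : ∀ x → 0# ≤ x * x
  square-nonNeg x with total 0# x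
  ... | inj₁ 0≤x = *-nonNeg 0≤x 0≤x
  -- Here `x` is `- d`, so its square is that of the nonnegative `d`; the chain adds and removes
  -- multiples of `x + d`.
  ... | inj₂ x≤0 with d , 0≤d , 0≈x+d ← ≤⇒∃+ x≤0 = begin
    0#                     ≤⟨ *-nonNeg 0≤d 0≤d ⟩
    d * d                  ≈⟨ +-identityˡ _ ⟨
    0# + d * d             ≈⟨ +-congʳ (zeroʳ x) ⟨
    x * 0# + d * d         ≈⟨ +-congʳ (*-congˡ 0≈x+d) ⟩
    x * (x + d) + d * d    ≈⟨ solve 2 (λ x d → x :* (x :+ d) :+ d :* d :=
                                x :* x :+ d :* (x :+ d)) refl x d ⟩
    x * x + d * (x + d)    ≈⟨ +-congˡ (*-congˡ 0≈x+d) ⟨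
    x * x + d * 0#         ≈⟨ +-congˡ (zeroʳ d) ⟩
    x * x + 0#             ≈⟨ +-identityʳ _ ⟩
    x * x                  ∎

  0≤1 : 0# ≤ 1#
  0≤1 = ≤-respʳ (*-identityˡ 1#) (square-nonNeg 1#)

  +≈0⇒≈0 : ∀ {x y} → 0# ≤ x → 0# ≤ y → x + y ≈ 0# → x ≈ 0#
  +≈0⇒≈0 0≤x 0≤y x+y≈0 = antisym (≤-respʳ x+y≈0 (x≤x+y 0≤y)) 0≤x

  *-cancelˡ-≈ : ∀ {z x y} → ¬ (z ≈ 0#) → z * x ≈ z * y → x ≈ y
  *-cancelˡ-≈ {z} {x} {y} z≉0 zx≈zy with w , zw≈1 ← inverse z z≉0 = begin-equality
    x            ≈⟨ *-identityˡ x ⟨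
    1# * x       ≈⟨ *-congʳ (trans (*-comm w z) zw≈1) ⟨
    (w * z) * x  ≈⟨ *-assoc w z x ⟩
    w * (z * x)  ≈⟨ *-congˡ zx≈zy ⟩
    w * (z * y)  ≈⟨ *-assoc w z y ⟨
    (w * z) * y  ≈⟨ *-congʳ (trans (*-comm w z) zw≈1) ⟩
    1# * y       ≈⟨ *-identityˡ y ⟩
    y            ∎

  *≈0⇒≈0ʳ : ∀ {x y} → ¬ (x ≈ 0#) → x * y ≈ 0# → y ≈ 0#
  *≈0⇒≈0ʳ {x} x≉0 xy≈0 = *-cancelˡ-≈ x≉0 (trans xy≈0 (sym (zeroʳ x)))

  *-nonZero : ∀ {x y} → ¬ (x ≈ 0#) → ¬ (y ≈ 0#) → ¬ (x * y ≈ 0#)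
  *-nonZero x≉0 y≉0 = y≉0 ∘ *≈0⇒≈0ʳ x≉0

  *-cancelˡ-≤ : ∀ {z x y} → 0# ≤ z → ¬ (z ≈ 0#) → z * x ≤ z * y → x ≤ y
  *-cancelˡ-≤ {z} {x} {y} 0≤z z≉0 zx≤zy with total x y
  ... | inj₁ x≤y = x≤y
  ... | inj₂ y≤x = ≤-reflexive (*-cancelˡ-≈ z≉0 (antisym zx≤zy (*-monoˡ-≤ 0≤z y≤x)))

  -- In an ordered field `1# + 1#` is nonzero: nonnegative summands of a zero sum vanish.
  x+x≈0⇒x≈0 : ∀ {x} → x + x ≈ 0# → x ≈ 0#
  x+x≈0⇒x≈0 {x} x+x≈0 = *≈0⇒≈0ʳ (1≉0 ∘ +≈0⇒≈0 0≤1 0≤1)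
    (trans (solve 1 (λ x → (con 1 :+ con 1) :* x := x :+ x) refl x) x+x≈0)

  divide : ∀ {t} → ¬ (t ≈ 0#) → ∀ x → ∃ λ u → u * t ≈ x
  divide {t} t≉0 x with w , tw≈1 ← inverse t t≉0 =
    x * w , trans (*-assoc x w t)
      (trans (*-congˡ (trans (*-comm w t) tw≈1)) (*-identityʳ x))

  -- Writing `y` as `x + d`, the right side exceeds the left by exactly `d * d`.
  4xy≤[x+y]²-ordered : ∀ {x y} → x ≤ y → (x * y + x * y) + (x * y + x * y) ≤ (x + y) * (x + y)
  4xy≤[x+y]²-ordered {x} {y} x≤y with d , _ , y≈x+d ← ≤⇒∃+ x≤y = begin
    (x * y + x * y) + (x * y + x * y)
      ≈⟨ +-cong (+-cong xy xy) (+-cong xy xy) ⟩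
    (x * (x + d) + x * (x + d)) + (x * (x + d) + x * (x + d))
      ≤⟨ x≤x+y (square-nonNeg d) ⟩
    (x * (x + d) + x * (x + d)) + (x * (x + d) + x * (x + d)) + d * d
      ≈⟨ solve 2 (λ x d →
           (x :* (x :+ d) :+ x :* (x :+ d)) :+ (x :* (x :+ d) :+ x :* (x :+ d)) :+ d :* d :=
           (x :+ (x :+ d)) :* (x :+ (x :+ d))) refl x d ⟩
    (x + (x + d)) * (x + (x + d))
      ≈⟨ *-cong (+-congˡ y≈x+d) (+-congˡ y≈x+d) ⟨
    (x + y) * (x + y) ∎
    where
    xy : x * y ≈ x * (x + d)
    xy = *-congˡ y≈x+d

  4xy≤[x+y]² : ∀ x y → (x * y + x * y) + (x * y + x * y) ≤ (x + y) * (x + y)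
  4xy≤[x+y]² x y with total x y
  ... | inj₁ x≤y = 4xy≤[x+y]²-ordered x≤y
  ... | inj₂ y≤x = begin
    (x * y + x * y) + (x * y + x * y)  ≈⟨ +-cong (+-cong xy≈yx xy≈yx) (+-cong xy≈yx xy≈yx) ⟩
    (y * x + y * x) + (y * x + y * x)  ≤⟨ 4xy≤[x+y]²-ordered y≤x ⟩
    (y + x) * (y + x)                  ≈⟨ *-cong (+-comm y x) (+-comm y x) ⟩
    (x + y) * (x + y)                  ∎
    where
    xy≈yx : x * y ≈ y * x
    xy≈yx = *-comm x y

  -- Square roots from suprema.

  module _ {x t : Carrier} (0≤x : 0# ≤ x) (0≤t : 0# ≤ t) (t≉0 : ¬ (t ≈ 0#)) (x≤t² : x ≤ t * t) where

    -- If `t ≤ y`, then `t * y ≤ y * y ≤ x ≤ t * t ≤ t * y`, so equality holds and `t` cancels.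
    square≤⇒≤ : ∀ y → y * y ≤ x → y ≤ t
    square≤⇒≤ y y²≤x with total y t
    ... | inj₁ y≤t = y≤t
    ... | inj₂ t≤y = ≤-reflexive (*-cancelˡ-≈ t≉0 (antisym ty≤t² (*-monoˡ-≤ 0≤t t≤y)))
      where
      ty≤t² : t * y ≤ t * t
      ty≤t² = begin
        t * y  ≈⟨ *-comm t y ⟩
        y * t  ≤⟨ *-monoˡ-≤ (≤-trans 0≤t t≤y) t≤y ⟩
        y * y  ≤⟨ y²≤x ⟩
        x      ≤⟨ x≤t² ⟩
        t * t  ∎

    -- `u` is `x / t`. After multiplication by `t * t` the claim reads `x * x ≤ x * (t * t)`.
    quotient-square≤ : ∀ {u} → u * t ≈ x → u * u ≤ x
    quotient-square≤ {u} ut≈x = *-cancelˡ-≤ (*-nonNeg 0≤t 0≤t) (*-nonZero t≉0 t≉0) $ begin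
      (t * t) * (u * u)  ≈⟨ solve 2 (λ t u → (t :* t) :* (u :* u) := (u :* t) :* (u :* t)) refl t u ⟩
      (u * t) * (u * t)  ≈⟨ *-cong ut≈x ut≈x ⟩
      x * x              ≤⟨ *-monoˡ-≤ 0≤x x≤t² ⟩
      x * (t * t)        ≈⟨ *-comm x (t * t) ⟩
      (t * t) * x        ∎

  SquareBelow : Carrier → Pred Carrier 0ℓ
  SquareBelow x y = y * y ≤ x

  module Newton {x s t : Carrier} (0≤x : 0# ≤ x) (0≤s : 0# ≤ s) (s≉0 : ¬ (s ≈ 0#))
                (2st≈s²+x : (s + s) * t ≈ s * s + x) where

    0≤2s : 0# ≤ s + s
    0≤2s = +-nonNeg 0≤s 0≤s

    2s≉0 : ¬ (s + s ≈ 0#)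
    2s≉0 = s≉0 ∘ x+x≈0⇒x≈0

    0≤t : 0# ≤ t
    0≤t = *-cancelˡ-≤ 0≤2s 2s≉0 $ begin
      (s + s) * 0#  ≈⟨ zeroʳ (s + s) ⟩
      0#            ≤⟨ +-nonNeg (square-nonNeg s) 0≤x ⟩
      s * s + x     ≈⟨ 2st≈s²+x ⟨
      (s + s) * t   ∎

    t≉0 : ¬ (t ≈ 0#)
    t≉0 t≈0 = *-nonZero s≉0 s≉0 (+≈0⇒≈0 (square-nonNeg s) 0≤x
      (trans (sym 2st≈s²+x) (trans (*-congˡ t≈0) (zeroʳ (s + s)))))

    -- Arithmetic-geometric mean inequality for `s * s` and `x`: `4 s² x ≤ (s² + x)² = (2s)² t²`,
    -- and `(2s)²` cancels.
    x≤t² : x ≤ t * t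
    x≤t² = *-cancelˡ-≤ (square-nonNeg (s + s)) (*-nonZero 2s≉0 2s≉0) $ begin
      ((s + s) * (s + s)) * x
        ≈⟨ solve 2 (λ s x → ((s :+ s) :* (s :+ s)) :* x :=
             ((s :* s) :* x :+ (s :* s) :* x) :+ ((s :* s) :* x :+ (s :* s) :* x)) refl s x ⟩
      ((s * s) * x + (s * s) * x) + ((s * s) * x + (s * s) * x)
        ≤⟨ 4xy≤[x+y]² (s * s) x ⟩
      (s * s + x) * (s * s + x)
        ≈⟨ *-cong 2st≈s²+x 2st≈s²+x ⟨
      ((s + s) * t) * ((s + s) * t)
        ≈⟨ solve 2 (λ s t → ((s :+ s) :* t) :* ((s :+ s) :* t) :=
             ((s :+ s) :* (s :+ s)) :* (t :* t)) refl s t ⟩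
      ((s + s) * (s + s)) * (t * t) ∎

  -- The Newton iterate t = (s² + x)/2s of s satisfies t² ≥ x. So t is an upper
  -- bound of {y | y² ≤ x}, whence s ≤ t and s² ≤ x; and x/t lies in this set,
  -- whence x/t ≤ s and x ≤ s².
  supremum-square : ∀ {x s} → 0# ≤ x → 0# ≤ s → ¬ (s ≈ 0#) → s ∈ UpperBound (SquareBelow x) →
                    (∀ b → b ∈ UpperBound (SquareBelow x) → s ≤ b) → s * s ≈ x
  supremum-square {x} {s} 0≤x 0≤s s≉0 upper least =
    let t , t2s≈s²+x = divide (s≉0 ∘ x+x≈0⇒x≈0) (s * s + x)
    in  iterate (trans (*-comm (s + s) t) t2s≈s²+x)
    where
    iterate : ∀ {t} → (s + s) * t ≈ s * s + x → s * s ≈ x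
    iterate {t} 2st≈s²+x = antisym s²≤x (let u , ut≈x = divide t≉0 x in x≤s² ut≈x)
      where
      open Newton 0≤x 0≤s s≉0 2st≈s²+x

      s²≤x : s * s ≤ x
      s²≤x = +-cancelˡ-≤ (s * s) $ begin
        s * s + s * s  ≈⟨ distribʳ s s s ⟨
        (s + s) * s    ≤⟨ *-monoˡ-≤ 0≤2s (least t (square≤⇒≤ 0≤x 0≤t t≉0 x≤t²)) ⟩
        (s + s) * t    ≈⟨ 2st≈s²+x ⟩
        s * s + x      ∎

      x≤s² : ∀ {u} → u * t ≈ x → x ≤ s * s
      x≤s² {u} ut≈x = +-cancelˡ-≤ x $ begin
        x + x          ≈⟨ +-cong ut≈x ut≈x ⟨
        u * t + u * t  ≈⟨ solve 2 (λ t u → u :* t :+ u :* t := (t :+ t) :* u) refl t u ⟩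
        (t + t) * u    ≤⟨ *-monoˡ-≤ (+-nonNeg 0≤t 0≤t)
                            (upper u (quotient-square≤ 0≤x 0≤t t≉0 x≤t² ut≈x)) ⟩
        (t + t) * s    ≈⟨ solve 2 (λ s t → (t :+ t) :* s := (s :+ s) :* t) refl s t ⟩
        (s + s) * t    ≈⟨ 2st≈s²+x ⟩
        s * s + x      ≈⟨ +-comm (s * s) x ⟩
        x + s * s      ∎

  sqrt-positive : ∀ {x} → 0# ≤ x → ¬ (x ≈ 0#) → ∃ λ s → s * s ≈ x
  sqrt-positive {x} 0≤x x≉0 =
    -- The witness `1# + x` bounds the set because its square is at least `x`, whether or not `x` is
    -- below one. `v` is `x / (1# + x)`.
    let s , upper , least = complete (SquareBelow x) (0# , 0∈SquareBelow)
                              (1# + x , square≤⇒≤ 0≤x 0≤1+x 1+x≉0 x≤[1+x]²)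
        v , v[1+x]≈x      = divide 1+x≉0 x
    in  s , supremum-square 0≤x (upper 0# 0∈SquareBelow) (s≉0 upper v[1+x]≈x) upper least
    where
    0∈SquareBelow : 0# ∈ SquareBelow x
    0∈SquareBelow = ≤-respˡ (sym (zeroˡ 0#)) 0≤x

    0≤1+x : 0# ≤ 1# + x
    0≤1+x = +-nonNeg 0≤1 0≤x

    1+x≉0 : ¬ (1# + x ≈ 0#)
    1+x≉0 = 1≉0 ∘ +≈0⇒≈0 0≤1 0≤x

    x≤[1+x]² : x ≤ (1# + x) * (1# + x)
    x≤[1+x]² = begin
      x                       ≤⟨ x≤x+y (+-nonNeg 0≤1+x (square-nonNeg x)) ⟩
      x + ((1# + x) + x * x)  ≈⟨ solve 1 (λ x → x :+ ((con 1 :+ x) :+ x :* x) :=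
                                   (con 1 :+ x) :* (con 1 :+ x)) refl x ⟩
      (1# + x) * (1# + x)     ∎

    -- The quotient `v` lies in the set, so `v ≤ s`; with `s` zero, multiplying by `1# + x` gives
    -- `x ≤ 0#`.
    s≉0 : ∀ {s v} → s ∈ UpperBound (SquareBelow x) → v * (1# + x) ≈ x → ¬ (s ≈ 0#)
    s≉0 {s} {v} upper v[1+x]≈x s≈0 = x≉0 (antisym x≤0 0≤x)
      where
      x≤0 : x ≤ 0#
      x≤0 = begin
        x             ≈⟨ trans (*-comm (1# + x) v) v[1+x]≈x ⟨
        (1# + x) * v  ≤⟨ *-monoˡ-≤ 0≤1+x
                           (upper v (quotient-square≤ 0≤x 0≤1+x 1+x≉0 x≤[1+x]² v[1+x]≈x)) ⟩
        (1# + x) * s  ≈⟨ trans (*-congˡ s≈0) (zeroʳ (1# + x)) ⟩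
        0#            ∎

  module _ (em : ExcludedMiddle 0ℓ) where

    square≈0⇒≈0 : ∀ {x} → x * x ≈ 0# → x ≈ 0#
    square≈0⇒≈0 {x} x²≈0 with em {x ≈ 0#}
    ... | yes x≈0 = x≈0
    ... | no  x≉0 = contradiction x²≈0 (*-nonZero x≉0 x≉0)

    -- Zero is split off because the Newton iterate divides by the supremum.
    sqrt : ∀ {x} → 0# ≤ x → ∃ λ s → s * s ≈ x
    sqrt {x} 0≤x with em {x ≈ 0#}
    ... | yes x≈0 = 0# , trans (zeroˡ 0#) (sym x≈0)
    ... | no  x≉0 = sqrt-positive 0≤x x≉0

    square≈1⇒≈-1 : ∀ {x} → x * x ≈ 1# → ¬ (x ≈ 1#) → x ≈ - 1#
    square≈1⇒≈-1 {x} x²≈1 x≉1 = G.inverseʳ-unique 1# x (*≈0⇒≈0ʳ x-1≉0 (begin-equality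
      (x + - 1#) * (1# + x)
        -- `- 1#` enters the solver as an atom `n`; the product is `x * x + n` up to a multiple of
        -- `1# + n`, which is zero.
        ≈⟨ solve 2 (λ x n → (x :+ n) :* (con 1 :+ x) := (x :* x :+ n) :+ x :* (con 1 :+ n)) refl x (- 1#) ⟩
      (x * x + - 1#) + x * (1# + - 1#)
        ≈⟨ +-cong (trans (+-congʳ x²≈1) (-‿inverseʳ 1#)) (trans (*-congˡ (-‿inverseʳ 1#)) (zeroʳ x)) ⟩
      0# + 0#
        ≈⟨ +-identityˡ 0# ⟩
      0# ∎))
      where
      x-1≉0 : ¬ (x + - 1# ≈ 0#)
      x-1≉0 p = x≉1 (G.x∙y⁻¹≈ε⇒x≈y x 1# p)

-- Induction on the derivation: each passage to a face composes one more inclusion.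
closure⇒⊆generator : ∀ {m} {G : Hypergraph m} {α} → α ∈ SimplicialClosure G →
                     ∃ λ β → β ∈ G × α ⊆ₛ β
closure⇒⊆generator (generator α∈G) = _ , α∈G , λ i∈α → i∈α
closure⇒⊆generator (face β⊆α α∈K) with γ , γ∈G , α⊆γ ← closure⇒⊆generator α∈K =
  γ , γ∈G , λ i∈β → α⊆γ (β⊆α i∈β)

-- Free torus actions and zero sets.

module FreeActions (em : ExcludedMiddle 0ℓ) (R : CompleteOrderedField) where

  open CompleteOrderedField R hiding (zero)
  open ToricTopology R
  open OrderedFieldProperties R
  open TotalOrder totalOrder using () renaming (≤-respˡ-≈ to ≤-respˡ)
  private
    module G = GroupProperties +-group
    module RP = RingProperties ring
    module Circle where
      open AbelianGroup circle public
      open GroupProperties group public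

  ≈ᶜ-sym : ∀ {z w} → z ≈ᶜ w → w ≈ᶜ z
  ≈ᶜ-sym (p , q) = sym p , sym q

  ≈ᶜ-trans : ∀ {z w v} → z ≈ᶜ w → w ≈ᶜ v → z ≈ᶜ v
  ≈ᶜ-trans (p , q) (r , s) = trans p r , trans q s

  ∣x+0i∣² : ∀ x → ∣ x , 0# ∣² ≈ x * x
  ∣x+0i∣² x = trans (+-congˡ (zeroˡ 0#)) (+-identityʳ (x * x))

  ∣∣²≈0⇒≈0 : ∀ z → ∣ z ∣² ≈ 0# → z ≈ᶜ 0ᶜ
  ∣∣²≈0⇒≈0 (a , b) p =
    square≈0⇒≈0 em (+≈0⇒≈0 (square-nonNeg a) (square-nonNeg b) p) ,
    square≈0⇒≈0 em (+≈0⇒≈0 (square-nonNeg b) (square-nonNeg a) (trans (+-comm _ _) p))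

  *ᶜ-zeroʳ : ∀ t → t *ᶜ 0ᶜ ≈ᶜ 0ᶜ
  *ᶜ-zeroʳ (a , b) =
    trans (+-cong (zeroʳ a) (trans (-‿cong (zeroʳ b)) RP.-0#≈0#)) (+-identityˡ 0#) ,
    trans (+-cong (zeroʳ a) (zeroʳ b)) (+-identityˡ 0#)

  *ᶜ-real : ∀ t x → t *ᶜ (x , 0#) ≈ᶜ (x * proj₁ t , x * proj₂ t)
  *ᶜ-real (a , b) x =
    trans (+-cong (*-comm a x) (trans (-‿cong (zeroʳ b)) RP.-0#≈0#)) (+-identityʳ (x * a)) ,
    trans (+-cong (zeroʳ a) (*-comm b x)) (+-identityˡ (x * b))

  -- Multiplying `t z = z` by the conjugate of `z` replaces `z` by the real number `∣ z ∣²`, which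
  -- cancels from both coordinates of `t`.
  fixes-nonZero⇒≈1 : ∀ {t z} → ¬ (∣ z ∣² ≈ 0#) → t *ᶜ z ≈ᶜ z → t ≈ᶜ 1ᶜ
  fixes-nonZero⇒≈1 {t} {z} N≉0 tz≈z =
    *-cancelˡ-≈ N≉0 (trans (proj₁ Nt≈N) (sym (*-identityʳ N))) ,
    *≈0⇒≈0ʳ N≉0 (proj₂ Nt≈N)
    where
    N : ℝ
    N = ∣ z ∣²

    Nt≈N : (N * proj₁ t , N * proj₂ t) ≈ᶜ (N , 0#)
    Nt≈N =
      ≈ᶜ-trans (≈ᶜ-sym (*ᶜ-real t N))
      (≈ᶜ-trans (*ᶜ-cong {t} {t} (refl , refl) (≈ᶜ-sym (*ᶜ-conj z)))
      (≈ᶜ-trans (≈ᶜ-sym (*ᶜ-assoc t z (conj z)))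
      (≈ᶜ-trans (*ᶜ-cong {w = conj z} {w′ = conj z} tz≈z (refl , refl)) (*ᶜ-conj z))))

  -- Says that `H` meets trivially each coordinate subgroup `T^α`, the elements equal to one outside
  -- `α`.
  FreeOutside : ∀ {m} → Pred (T m) 0ℓ → Hypergraph m → Set
  FreeOutside H G =
    ∀ t → t ∈ H → ∀ α → α ∈ G → (∀ i → i ∉ₛ α → proj₁ (t i) ≈ᶜ 1ᶜ) → t ≈ᵀ 1ᵀ

  -- Only inclusions are asked for, not equality of zero sets: a point of `𝒵 G` may have nonzero
  -- coordinates inside `α`. This suffices because a larger zero set has a larger stabilizer.
  ZeroSetsGeneratedBy : ∀ {m} → Pred (Vector ℂ m) 0ℓ → Hypergraph m → Set
  ZeroSetsGeneratedBy X G =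
    (∀ z → z ∈ X → ∃ λ α → α ∈ G × (∀ i → i ∉ₛ α → ¬ (∣ z i ∣² ≈ 0#))) ×
    (∀ α → α ∈ G → ∃ λ z → z ∈ X × (∀ i → i ∈ₛ α → z i ≈ᶜ 0ᶜ))

  -- The stabilizer of a point consists of the elements equal to one off its zero set. Hence
  -- `realize` tests every `α`, and `zeroSet` encloses every stabilizer in some `T^α`.
  actsFreely⇔freeOutside : ∀ {m} {X : Pred (Vector ℂ m) 0ℓ} {G} → ZeroSetsGeneratedBy X G →
                           ∀ H → ActsFreely H X ⇔ FreeOutside H G
  actsFreely⇔freeOutside {X = X} {G} (zeroSet , realize) H = mk⇔ to from
    where
    to : ActsFreely H X → FreeOutside H G
    to free t t∈H α α∈G t≈1 with z , z∈X , z≈0 ← realize α α∈G = free t t∈H z z∈X fixed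
      where
      fixed : t · z ≈ᵛ z
      fixed i with i ∈? α
      ... | yes i∈α = ≈ᶜ-trans (*ᶜ-cong {proj₁ (t i)} {proj₁ (t i)} (refl , refl) (z≈0 i i∈α))
                        (≈ᶜ-trans (*ᶜ-zeroʳ (proj₁ (t i))) (≈ᶜ-sym (z≈0 i i∈α)))
      ... | no  i∉α = ≈ᶜ-trans (*ᶜ-cong {w = z i} {w′ = z i} (t≈1 i i∉α) (refl , refl))
                        (*ᶜ-identityˡ (z i))

    from : FreeOutside H G → ActsFreely H X
    from free t t∈H z z∈X tz≈z with α , α∈G , z≉0 ← zeroSet z z∈X =
      free t t∈H α α∈G λ i i∉α → fixes-nonZero⇒≈1 (z≉0 i i∉α) (tz≈z i)

  sameZeroSets⇒freeRank : ∀ {m} {X Y : Pred (Vector ℂ m) 0ℓ} {G} → ZeroSetsGeneratedBy X G →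
                          ZeroSetsGeneratedBy Y G → ∀ {k} → FreeRank X k → FreeRank Y k
  sameZeroSets⇒freeRank gX gY (H , free) =
    H , Equivalence.from (actsFreely⇔freeOutside gY _)
          (Equivalence.to (actsFreely⇔freeOutside gX _) free)

  -- Zero sets of the four spaces.

  polyhedralProduct-zeroSets :
    ∀ {m} {X A : Pred ℂ 0ℓ} (G : Hypergraph m) → 0ᶜ ∈ X → 1ᶜ ∈ A →
    (∀ z → z ∈ A → ¬ (∣ z ∣² ≈ 0#)) → ZeroSetsGeneratedBy (PolyhedralProduct X A G) G
  polyhedralProduct-zeroSets {X = X} {A} G 0∈X 1∈A A≉0 =
    (λ z (α , α∈G , _ , z∈A) → α , α∈G , λ i i∉α → A≉0 (z i) (z∈A i i∉α)) ,
    (λ α α∈G → point α , (α , α∈G , inside α , outside α) , zeroes α)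
    where
    -- Vanishes on exactly `α`, the most that the block of `α` allows, since `A` omits zero.
    point : ∀ α → Vector ℂ _
    point α i = if does (i ∈? α) then 0ᶜ else 1ᶜ

    inside : ∀ α i → i ∈ₛ α → point α i ∈ X
    inside α i i∈α with i ∈? α
    ... | yes _   = 0∈X
    ... | no  i∉α = contradiction i∈α i∉α

    outside : ∀ α i → i ∉ₛ α → point α i ∈ A
    outside α i i∉α with i ∈? α
    ... | yes i∈α = contradiction i∈α i∉α
    ... | no  _   = 1∈A

    zeroes : ∀ α i → i ∈ₛ α → point α i ≈ᶜ 0ᶜ
    zeroes α i i∈α with i ∈? α
    ... | yes _   = refl , refl
    ... | no  i∉α = contradiction i∈α i∉α

  𝒵-zeroSets : ∀ {m} (G : Hypergraph m) → ZeroSetsGeneratedBy (𝒵 G) G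
  𝒵-zeroSets G = polyhedralProduct-zeroSets {X = D²} {A = S¹} G
    (≤-respˡ (sym (trans (∣x+0i∣² 0#) (zeroˡ 0#))) 0≤1) ∣1∣²
    (λ z ∣z∣²≈1 ∣z∣²≈0 → 1≉0 (trans (sym ∣z∣²≈1) ∣z∣²≈0))

  -- A zero set inside a face lies inside a generator containing that face, and generators are
  -- themselves faces.
  closure-zeroSets : ∀ {m} {X : Pred (Vector ℂ m) 0ℓ} {G} →
                     ZeroSetsGeneratedBy X (SimplicialClosure G) → ZeroSetsGeneratedBy X G
  closure-zeroSets {X = X} {G} (zeroSet , realize) = zeroSet′ , λ α α∈G → realize α (generator α∈G)
    where
    zeroSet′ : ∀ z → z ∈ X → ∃ λ β → β ∈ G × (∀ i → i ∉ₛ β → ¬ (∣ z i ∣² ≈ 0#))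
    zeroSet′ z z∈X with α , α∈K , z≉0 ← zeroSet z z∈X
                   with β , β∈G , α⊆β ← closure⇒⊆generator α∈K =
      β , β∈G , λ i i∉β → z≉0 i (i∉β ∘ α⊆β)

  module _ {n m : ℕ} (P : Polytope n m) where
    open Polytope P

    -- A point over `x` vanishes exactly at the facets through `x`, and these sets of facets are the
    -- members of `G[ P ]`.
    𝒵[]-zeroSets : ZeroSetsGeneratedBy 𝒵[ P ] G[ P ]
    𝒵[]-zeroSets = zeroSet , realize
      where
      zeroSet : ∀ z → z ∈ 𝒵[ P ] → ∃ λ α → α ∈ G[ P ] × (∀ i → i ∉ₛ α → ¬ (∣ z i ∣² ≈ 0#))
      zeroSet z (x , x∈P , ∣z∣²≈jx) with α , ∈α⇔ ← comprehension em (λ i → x ∈ ℱ i) =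
        α , (x , x∈P , ∈α⇔) , λ i i∉α ∣zi∣²≈0 →
          i∉α (Equivalence.from (∈α⇔ i) (x∈P , trans (sym (∣z∣²≈jx i)) ∣zi∣²≈0))

      realize : ∀ α → α ∈ G[ P ] → ∃ λ z → z ∈ 𝒵[ P ] × (∀ i → i ∈ₛ α → z i ≈ᶜ 0ᶜ)
      realize α (x , x∈P , ∈α⇔) = z , (x , x∈P , ∣z∣²≈jx) , λ i i∈α →
        ∣∣²≈0⇒≈0 (z i) (trans (∣z∣²≈jx i) (proj₂ (Equivalence.to (∈α⇔ i) i∈α)))
        where
        z : Vector ℂ m
        -- Real square roots lift `x` to the complex space; they exist because `x∈P` makes each
        -- `j x i` nonnegative.
        z i = proj₁ (sqrt em (x∈P i)) , 0#

        ∣z∣²≈jx : ∀ i → ∣ z i ∣² ≈ j x i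
        ∣z∣²≈jx i = trans (∣x+0i∣² _) (proj₂ (sqrt em (x∈P i)))

    U[]-zeroSets : ZeroSetsGeneratedBy U[ P ] G[ P ]
    U[]-zeroSets = polyhedralProduct-zeroSets {X = U} {A = ℂ*} G[ P ] tt (1≉0 ∘ proj₁) (λ z z≉0 → z≉0 ∘ ∣∣²≈0⇒≈0 z)

  -- Existence of the maximal rank.

  trivialSubgroup : ∀ m → ToricSubgroup 0 m
  trivialSubgroup m = record
    { φ                   = λ _ → 1ᵀ
    ; isGroupMonomorphism = record
      { isGroupHomomorphism = record
        { isMonoidHomomorphism = record
          { isMagmaHomomorphism = record
            { isRelHomomorphism = record { cong = λ _ _ → refl , refl }
            ; homo = λ _ _ _ → ≈ᶜ-sym (*ᶜ-identityˡ 1ᶜ)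
            }
          ; ε-homo = λ _ → refl , refl
          }
        ; ⁻¹-homo = λ _ _ → ≈ᶜ-sym Circle.ε⁻¹≈ε
        }
      -- Any two elements of `T 0` agree because `Fin 0` has no index; the same makes the inverse
      -- continuous.
      ; injective = λ _ ()
      }
    ; φ-continuous        = λ _ ε 0<ε → ε , 0<ε , λ _ _ _ → close ε 0<ε
    ; φ⁻¹-continuous      = λ _ ε 0<ε → ε , 0<ε , λ _ _ ()
    }
    where
    close : ∀ ε → 0# < ε → ∣ 1ᶜ -ᶜ 1ᶜ ∣² < ε * ε
    close ε (_ , 0≉ε) =
      ≤-respˡ (sym ∣1-1∣²≈0) (square-nonNeg ε) ,
      λ p → *-nonZero ε≉0 ε≉0 (trans (sym p) ∣1-1∣²≈0)
      where
      ε≉0 : ¬ (ε ≈ 0#)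
      ε≉0 = 0≉ε ∘ sym

      ∣1-1∣²≈0 : ∣ 1ᶜ -ᶜ 1ᶜ ∣² ≈ 0#
      ∣1-1∣²≈0 = trans (+-cong (trans (*-congʳ (-‿inverseʳ 1#)) (zeroˡ _))
                               (trans (*-congʳ (-‿inverseʳ 0#)) (zeroˡ _))) (+-identityˡ 0#)

  freeRank-zero : ∀ {m} (X : Pred (Vector ℂ m) 0ℓ) → FreeRank X 0
  freeRank-zero X = trivialSubgroup _ , λ { _ (_ , 1≈t) _ _ _ i → ≈ᶜ-sym (1≈t i) }

  sign : Fin 2 → AbelianGroup.Carrier circle
  sign zero       = AbelianGroup.ε circle
  sign (suc zero) = (- 1# , 0#) ,
    trans (∣x+0i∣² (- 1#)) (trans (RP.-1*x≈-x (- 1#)) (G.⁻¹-involutive 1#))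

  sign-injective : ∀ e e′ → sign e Circle.≈ sign e′ → e ≡ e′
  sign-injective zero       zero       _ = ≡.refl
  sign-injective zero       (suc zero) (1≈-1 , _) =
    contradiction (x+x≈0⇒x≈0 (trans (+-congˡ 1≈-1) (-‿inverseʳ 1#))) 1≉0
  sign-injective (suc zero) zero       (-1≈1 , _) =
    contradiction (x+x≈0⇒x≈0 (trans (+-congˡ (sym -1≈1)) (-‿inverseʳ 1#))) 1≉0
  sign-injective (suc zero) (suc zero) _ = ≡.refl

  sign-involutive : ∀ e → sign e Circle.∙ sign e Circle.≈ Circle.ε
  sign-involutive zero       = Circle.identityˡ Circle.ε
  sign-involutive (suc zero) = ≈ᶜ-trans (*ᶜ-real (- 1# , 0#) (- 1#))
    (trans (RP.-1*x≈-x (- 1#)) (G.⁻¹-involutive 1#) , zeroʳ (- 1#))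

  -- An involution is its own inverse, hence its own conjugate, so its imaginary part equals its
  -- negative.
  involution⇒real : ∀ t → t Circle.∙ t Circle.≈ Circle.ε → proj₂ (proj₁ t) ≈ 0#
  involution⇒real t tt≈1 =
    x+x≈0⇒x≈0 (trans (+-congˡ (proj₂ (Circle.inverseˡ-unique t t tt≈1))) (-‿inverseʳ _))

  involution⇒sign : ∀ t → t Circle.∙ t Circle.≈ Circle.ε → ∃ λ e → sign e Circle.≈ t
  involution⇒sign t@((a , b) , ∣t∣²≈1) tt≈1 with em {a ≈ 1#}
  ... | yes a≈1 = zero , sym a≈1 , sym (involution⇒real t tt≈1)
  ... | no  a≉1 = suc zero , sym (square≈1⇒≈-1 em a²≈1 a≉1) , sym b≈0
    where
    b≈0 : b ≈ 0#
    b≈0 = involution⇒real t tt≈1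

    a²≈1 : a * a ≈ 1#
    a²≈1 = begin
      a * a          ≈⟨ +-identityʳ (a * a) ⟨
      a * a + 0#     ≈⟨ +-congˡ (trans (*-congʳ b≈0) (zeroˡ b)) ⟨
      a * a + b * b  ≈⟨ ∣t∣²≈1 ⟩
      1#             ∎
      where open ≈-Reasoning setoid

  rank≤ : ∀ {k m} → ToricSubgroup k m → k ℕ.≤ m
  rank≤ {k} {m} H = injective⇒exponent≤ signs signs-injective
    where
    open ToricSubgroup H
    open GroupMorphisms (AbelianGroup.rawGroup (torus k)) (AbelianGroup.rawGroup (torus m))
    open IsGroupMonomorphism isGroupMonomorphism

    -- A homomorphism sends squares equal to one to squares equal to one, so every coordinate of the
    -- image is again a sign.
    φ-sign : ∀ e i → ∃ λ d → sign d Circle.≈ φ (sign ∘ e) i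
    φ-sign e i = involution⇒sign (φ s i) (φs²≈1 i)
      where
      s : T k
      s = sign ∘ e

      φs²≈1 : AbelianGroup._∙_ (torus m) (φ s) (φ s) ≈ᵀ 1ᵀ
      φs²≈1 = begin
        AbelianGroup._∙_ (torus m) (φ s) (φ s)  ≈⟨ ∙-homo s s ⟨
        φ (AbelianGroup._∙_ (torus k) s s)      ≈⟨ ⟦⟧-cong (sign-involutive ∘ e) ⟩
        φ 1ᵀ                                    ≈⟨ ε-homo ⟩
        1ᵀ                                      ∎
        where open ≈-Reasoning (AbelianGroup.setoid (torus m))

    signs : (Fin k → Fin 2) → (Fin m → Fin 2)
    signs e i = proj₁ (φ-sign e i)

    signs-injective : ∀ e e′ → signs e ≗ signs e′ → e ≗ e′
    signs-injective e e′ eq l = sign-injective (e l) (e′ l) (injective φe≈φe′ l)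
      where
      φe≈φe′ : φ (sign ∘ e) ≈ᵀ φ (sign ∘ e′)
      φe≈φe′ i = ≈ᶜ-trans (≈ᶜ-sym (proj₂ (φ-sign e i)))
        (≡.subst (λ d → sign d Circle.≈ φ (sign ∘ e′) i) (≡.sym (eq i)) (proj₂ (φ-sign e′ i)))

  -- Rank zero is always attained and `m` bounds all ranks, so the search for a greatest rank
  -- succeeds.
  buchstaberNumber-exists : ∀ {m} (X : Pred (Vector ℂ m) 0ℓ) → ∃ (IsBuchstaberNumber X)
  buchstaberNumber-exists {m} X =
    greatest em (FreeRank X) (freeRank-zero X) m (λ _ → rank≤ ∘ proj₁)

  -- Maximality needs the reverse comparison: a free rank on `Y` is carried back to `X`.
  sameZeroSets⇒buchstaberNumber :
    ∀ {m} {X Y : Pred (Vector ℂ m) 0ℓ} {G} → ZeroSetsGeneratedBy X G → ZeroSetsGeneratedBy Y G →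
    ∀ {s} → IsBuchstaberNumber X s → IsBuchstaberNumber Y s
  sameZeroSets⇒buchstaberNumber gX gY (rank , maximal) =
    sameZeroSets⇒freeRank gX gY rank , λ k → maximal k ∘ sameZeroSets⇒freeRank gY gX

proposition1 : ExcludedMiddle 0ℓ → (R : CompleteOrderedField) →
    let open ToricTopology R in
    ∀ {n m : ℕ} (P : Polytope n m) →
    ∃[ s ] (IsBuchstaberNumber 𝒵[ P ] s
    × IsBuchstaberNumber (𝒵 G[ P ]) s
    × IsBuchstaberNumber (𝒵 K[ P ]) s
    × IsBuchstaberNumber U[ P ] s)
proposition1 em R P =
  proj₁ s[P] , proj₂ s[P] , transfer (𝒵-zeroSets G[ P ]) ,
  -- Passing from `K[ P ]` to `G[ P ]` as generating family makes this space comparable with the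
  -- others.
  transfer (closure-zeroSets (𝒵-zeroSets K[ P ])) , transfer (U[]-zeroSets P)
  where
  open ToricTopology R
  open FreeActions em R

  s[P] : ∃ (IsBuchstaberNumber 𝒵[ P ])
  s[P] = buchstaberNumber-exists 𝒵[ P ]

  transfer : ∀ {Y} → ZeroSetsGeneratedBy Y G[ P ] → IsBuchstaberNumber Y (proj₁ s[P])
  transfer gY = sameZeroSets⇒buchstaberNumber (𝒵[]-zeroSets P) gY (proj₂ s[P])
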